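{- Let $P$ be a vertically degenerate 0-1 matrix with at least one 1-entry. Then $\mathrm{ex}(n,P)\le n^{1+o(1)}$, i.e., there is a function $\varepsilon(n)\to 0$ as $n\to\infty$ such that $\mathrm{ex}(n,P)\le n^{1+\varepsilon(n)}$ for all $n$.
   Context: A 0-1 matrix $A$ contains a 0-1 matrix $B$ (written $B\prec A$) if $B$ can be obtained from $A$ by deleting some rows, some columns, and changing some 1-entries to 0-entries. The weight $w(A)$ is the number of 1-entries of $A$. For a 0-1 matrix $P$ (a "pattern") with at least one 1-entry, $\mathrm{ex}(n,P)$ is the maximum weight of an $n\times n$ 0-1 matrix that does not contain $P$. An $l\times k$ 0-1 matrix $P$ is vertically separable if there exists $1\le a<l$ such that for all but at most one column $y\in[k]$, either $P(x,y)=0$ for every $x\le a$ or $P(x,y)=0$ for every $x>a$. A 0-1 matrix $P$ is vertically degenerate if every submatrix of $P$ (formed by a subset of rows and a subset of columns) either has a single row or is vertically separable. -}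

module Defs where

open import Data.Nat using (ℕ; zero; suc; _+_; _<_; _≤_)
open import Data.Fin using (Fin; toℕ)
open import Data.Bool using (Bool; true; false; if_then_else_)
open import Data.List using (List; map; allFin)
open import Data.Nat.ListAction using (sum)
open import Data.Product using (Σ; _×_; ∃; ∃-syntax)
open import Data.Sum using (_⊎_)
open import Relation.Binary.PropositionalEquality using (_≡_; _≢_)

-- An m × n 0-1 matrix (rows indexed by Fin m, columns by Fin n; true = 1-entry).
Matrix : ℕ → ℕ → Set
Matrix m n = Fin m → Fin n → Bool

StrictlyIncreasing : {a b : ℕ} → (Fin a → Fin b) → Set
StrictlyIncreasing {a} f = (i j : Fin a) → toℕ i < toℕ j → toℕ (f i) < toℕ (f j)

weight : {m n : ℕ} → Matrix m n → ℕ
weight {m} {n} A = sum (map (λ i → sum (map (λ j → if A i j then 1 else 0) (allFin n))) (allFin m))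

-- B ≺ A : B is obtained from A by deleting rows, columns, and turning some 1s into 0s.
_≺_ : {l k m n : ℕ} → Matrix l k → Matrix m n → Set
_≺_ {l} {k} {m} {n} B A =
  Σ (Fin l → Fin m) λ f → Σ (Fin k → Fin n) λ g →
    StrictlyIncreasing f × StrictlyIncreasing g ×
    ((x : Fin l) (y : Fin k) → B x y ≡ true → A (f x) (g y) ≡ true)

HasOne : {l k : ℕ} → Matrix l k → Set
HasOne {l} {k} P = Σ (Fin l) λ x → Σ (Fin k) λ y → P x y ≡ true

-- Column y is zero on the top a rows (rows x with x ≤ a in 1-based indexing),
-- or zero on the remaining rows.
ColumnSplits : {l k : ℕ} → Matrix l k → ℕ → Fin k → Set
ColumnSplits {l} P a y =
  ((x : Fin l) → toℕ x < a → P x y ≡ false) ⊎ ((x : Fin l) → a ≤ toℕ x → P x y ≡ false)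

-- Vertically separable: some 1 ≤ a < l such that all but at most one column split at a.
VerticallySeparable : {l k : ℕ} → Matrix l k → Set
VerticallySeparable {l} {k} P =
  Σ ℕ λ a → (1 ≤ a) × (a < l) ×
    ((y y′ : Fin k) → y ≢ y′ → ColumnSplits P a y ⊎ ColumnSplits P a y′)

submatrix : {l k l′ k′ : ℕ} → Matrix l k → (Fin l′ → Fin l) → (Fin k′ → Fin k) → Matrix l′ k′
submatrix P r c x y = P (r x) (c y)

VerticallyDegenerate : {l k : ℕ} → Matrix l k → Set
VerticallyDegenerate {l} {k} P =
  (l′ k′ : ℕ) (r : Fin l′ → Fin l) (c : Fin k′ → Fin k) →
  StrictlyIncreasing r → StrictlyIncreasing c → 1 ≤ l′ →
  (l′ ≡ 1) ⊎ VerticallySeparable (submatrix P r c)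

{-# OPTIONS --safe #-}
module Submission where

-- Write P as P₁ above P₂ sharing the column y₀. Cut the columns of a P-free matrix A into t blocks and repeatedly remove
-- k ones of one row lying in k different blocks. The ones left over are concentrated in at most k blocks in each row,
-- so recursion into the blocks bounds their number. By pigeonhole, many of the removed k-tuples use the same blocks
-- J₁ < ⋯ < J_k; among these it is enough to place the y-th column of P in the y-th block, so the order of columns no
-- longer matters. Cut the rows into windows. By induction on the number of rows of P, in each window all but few tuples
-- root, at their y₀-entry, copies of both P₁ and P₂ inside that window. Two such tuples sharing this entry's column in
-- different windows give P; otherwise each column of J_{y₀} meets only one window, and recursion into the windows bounds
-- the number of tuples.

open import Defs
open import Data.Bool using (true; false; if_then_else_)
import Data.Bool.Properties as Bool
open import Data.Fin using (Fin; zero; suc; toℕ; fromℕ<)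
import Data.Fin.Properties as Fin
open import Data.List using (List; []; _∷_; _++_; map; length; filter; tabulate; allFin; upTo; cartesianProduct)
import Data.List.Properties as List
open import Data.List.Membership.Propositional using (_∈_; find; lose)
open import Data.List.Membership.Propositional.Properties
  using (∈-filter⁺; ∈-filter⁻; ∈-map⁺; ∈-map⁻; ∈-cartesianProduct⁺; ∈-tabulate⁺; ∈-upTo⁺)
open import Data.List.Relation.Unary.All using (All; []; _∷_)
import Data.List.Relation.Unary.All as All
import Data.List.Relation.Unary.All.Properties as All
open import Data.List.Relation.Unary.AllPairs using (AllPairs; []; _∷_)
import Data.List.Relation.Unary.AllPairs as AllPairs
import Data.List.Relation.Unary.AllPairs.Properties as AllPairs
open import Data.List.Relation.Unary.Any using (Any; here; there; any?; _─_; index)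
open import Data.List.Relation.Unary.Unique.Propositional using (Unique)
import Data.List.Relation.Unary.Unique.Propositional.Properties as Unique
open import Data.Nat
open import Data.Nat.DivMod using (_/_; m/n*n≤m; m<n*o⇒m/o<n; /-monoˡ-≤; m≡m%n+[m/n]*n; m%n<n)
open import Data.Nat.ListAction using (sum)
open import Data.Nat.Properties
open import Data.Nat.Tactic.RingSolver using (solve-∀)
open import Data.Product using (Σ; _×_; _,_; proj₁; proj₂; ∃)
import Data.Product.Properties as ×
open import Data.Sum using (_⊎_; inj₁; inj₂; [_,_]′)
open import Function using (_∘_; id)
open import Relation.Binary.PropositionalEquality
open import Relation.Nullary using (¬_; Dec; yes; no; does; contradiction; ¬?)
open import Relation.Nullary.Decidable using (_→-dec_; _⊎-dec_; _×-dec_; decidable-stable)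
open import Relation.Unary using (Decidable)

private variable
  X : Set

-- Finite sums and double counting.

∑ : ℕ → (ℕ → ℕ) → ℕ
∑ zero    f = 0
∑ (suc r) f = f 0 + ∑ r (f ∘ suc)

∑-mono-≤ : ∀ r {f g : ℕ → ℕ} → (∀ j → j < r → f j ≤ g j) → ∑ r f ≤ ∑ r g
∑-mono-≤ zero    f≤g = z≤n
∑-mono-≤ (suc r) f≤g = +-mono-≤ (f≤g 0 z<s) (∑-mono-≤ r λ j j<r → f≤g (suc j) (s<s j<r))

∑-+ : ∀ r (f g : ℕ → ℕ) → ∑ r (λ j → f j + g j) ≡ ∑ r f + ∑ r g
∑-+ zero    f g = refl
∑-+ (suc r) f g = begin
  f 0 + g 0 + ∑ r (λ j → f (suc j) + g (suc j))    ≡⟨ cong (f 0 + g 0 +_) (∑-+ r (f ∘ suc) (g ∘ suc)) ⟩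
  f 0 + g 0 + (∑ r (f ∘ suc) + ∑ r (g ∘ suc))      ≡⟨ interchange (f 0) (g 0) _ _ ⟩
  f 0 + ∑ r (f ∘ suc) + (g 0 + ∑ r (g ∘ suc))      ∎
  where
  open ≡-Reasoning
  interchange : ∀ a b c d → a + b + (c + d) ≡ a + c + (b + d)
  interchange = solve-∀

∑-*ˡ : ∀ r c (f : ℕ → ℕ) → ∑ r (λ j → c * f j) ≡ c * ∑ r f
∑-*ˡ zero    c f = sym (*-zeroʳ c)
∑-*ˡ (suc r) c f =
  trans (cong (c * f 0 +_) (∑-*ˡ r c (f ∘ suc))) (sym (*-distribˡ-+ c (f 0) (∑ r (f ∘ suc))))

∑-const : ∀ r c → ∑ r (λ _ → c) ≡ r * c
∑-const zero    c = refl
∑-const (suc r) c = cong (c +_) (∑-const r c)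

indicator : {P : Set} → Dec P → ℕ
indicator P? = if does P? then 1 else 0

length-filter-∷ : {P : X → Set} (P? : Decidable P) (x : X) (xs : List X) →
  length (filter P? (x ∷ xs)) ≡ indicator (P? x) + length (filter P? xs)
length-filter-∷ P? x xs with does (P? x)
... | true  = refl
... | false = refl

module _ {Q : ℕ → X → Set} (Q? : ∀ j x → Dec (Q j x)) (r : ℕ) where

  private
    ∑-length-filter-∷ : ∀ x xs → ∑ r (λ j → length (filter (Q? j) (x ∷ xs))) ≡
                        ∑ r (λ j → indicator (Q? j x)) + ∑ r (λ j → length (filter (Q? j) xs))
    ∑-length-filter-∷ x xs =
      trans (≤-antisym (∑-mono-≤ r λ j _ → ≤-reflexive (length-filter-∷ (Q? j) x xs))
                       (∑-mono-≤ r λ j _ → ≤-reflexive (sym (length-filter-∷ (Q? j) x xs))))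
            (∑-+ r (λ j → indicator (Q? j x)) (λ j → length (filter (Q? j) xs)))

  -- Double counting of the pairs `(j , x)` with `Q j x`: summed over the elements first, each of
  -- them contributes at most `s`.
  ∑-length-filter-≤ : ∀ s xs → All (λ x → ∑ r (λ j → indicator (Q? j x)) ≤ s) xs →
    ∑ r (λ j → length (filter (Q? j) xs)) ≤ s * length xs
  ∑-length-filter-≤ s []       []         = ≤-reflexive (trans (∑-const r 0) (trans (*-zeroʳ r) (sym (*-zeroʳ s))))
  ∑-length-filter-≤ s (x ∷ xs) (le ∷ les) = begin
    ∑ r (λ j → length (filter (Q? j) (x ∷ xs)))                                  ≡⟨ ∑-length-filter-∷ x xs ⟩
    ∑ r (λ j → indicator (Q? j x)) + ∑ r (λ j → length (filter (Q? j) xs))   ≤⟨ +-mono-≤ le (∑-length-filter-≤ s xs les) ⟩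
    s + s * length xs                                                         ≡⟨ *-suc s (length xs) ⟨
    s * suc (length xs)                                                       ∎
    where open ≤-Reasoning

  length-≤-∑-filter : ∀ xs → All (λ x → 1 ≤ ∑ r (λ j → indicator (Q? j x))) xs →
    length xs ≤ ∑ r (λ j → length (filter (Q? j) xs))
  length-≤-∑-filter []       []         = z≤n
  length-≤-∑-filter (x ∷ xs) (ge ∷ ges) =
    ≤-trans (+-mono-≤ ge (length-≤-∑-filter xs ges)) (≤-reflexive (sym (∑-length-filter-∷ x xs)))

indicator-pos : {P : Set} (P? : Dec P) → P → 1 ≤ indicator P?
indicator-pos (yes _) p = ≤-refl
indicator-pos (no ¬p) p = contradiction p ¬p

∑-indicator-pos : {P : ℕ → Set} (P? : Decidable P) → ∀ r j → j < r → P j →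
  1 ≤ ∑ r (λ j → indicator (P? j))
∑-indicator-pos P? (suc r) zero    _         p = ≤-trans (indicator-pos (P? 0) p) (m≤m+n _ _)
∑-indicator-pos P? (suc r) (suc j) (s≤s j<r) p =
  ≤-trans (∑-indicator-pos (P? ∘ suc) r j j<r p) (m≤n+m _ (indicator (P? 0)))

-- Scanning the indices keeps the first `s` that satisfy `P`. With `s = 2` this finds two windows
-- that meet one column, with `s = k` it finds `k` column blocks that one row hits.
∑-indicator⇒increasing : {P : ℕ → Set} (P? : Decidable P) → ∀ r s → s ≤ ∑ r (λ j → indicator (P? j)) →
  Σ (Fin s → ℕ) λ f → (∀ x y → toℕ x < toℕ y → f x < f y) × (∀ x → P (f x) × f x < r)
∑-indicator⇒increasing P? r       zero    _  = (λ ()) , (λ ()) , (λ ())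
∑-indicator⇒increasing {P} P? (suc r) (suc s) le with P? 0
... | yes p0 with ∑-indicator⇒increasing {P ∘ suc} (P? ∘ suc) r s (s≤s⁻¹ le)
...   | f , inc , sat = f′ , inc′ , sat′
  where
  f′ : Fin (suc s) → ℕ
  f′ zero    = 0
  f′ (suc x) = suc (f x)
  inc′ : ∀ x y → toℕ x < toℕ y → f′ x < f′ y
  inc′ zero    (suc y) _         = z<s
  inc′ (suc x) (suc y) (s≤s x<y) = s<s (inc x y x<y)
  sat′ : ∀ x → P (f′ x) × f′ x < suc r
  sat′ zero    = p0 , z<s
  sat′ (suc x) = proj₁ (sat x) , s<s (proj₂ (sat x))
∑-indicator⇒increasing {P} P? (suc r) (suc s) le | no _
  with ∑-indicator⇒increasing {P ∘ suc} (P? ∘ suc) r (suc s) le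
... | f , inc , sat = suc ∘ f , (λ x y x<y → s<s (inc x y x<y)) , λ x → proj₁ (sat x) , s<s (proj₂ (sat x))

∑-indicator-≡-≤1 : ∀ r i → ∑ r (λ j → indicator (i ≟ j)) ≤ 1
∑-indicator-≡-≤1 r i with 2 ≤? ∑ r (λ j → indicator (i ≟ j))
... | no  ≱2 = s≤s⁻¹ (≰⇒> ≱2)
... | yes ≥2 with ∑-indicator⇒increasing (i ≟_) r 2 ≥2
...   | f , inc , sat = contradiction (trans (sym (proj₁ (sat zero))) (proj₁ (sat (suc zero))))
                                      (<⇒≢ (inc zero (suc zero) z<s))

module _ (β : X → ℕ) (r : ℕ) where

  length-≤-∑-fibres : ∀ xs → (∀ {x} → x ∈ xs → β x < r) →
    length xs ≤ ∑ r (λ j → length (filter (λ x → β x ≟ j) xs))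
  length-≤-∑-fibres xs β< = length-≤-∑-filter (λ j x → β x ≟ j) r xs
    (All.tabulate λ {x} x∈ → ∑-indicator-pos (β x ≟_) r (β x) (β< x∈) refl)

  ∑-fibres-≤-length : ∀ xs → ∑ r (λ j → length (filter (λ x → β x ≟ j) xs)) ≤ length xs
  ∑-fibres-≤-length xs = ≤-trans
    (∑-length-filter-≤ (λ j x → β x ≟ j) r 1 xs (All.tabulate λ {x} _ → ∑-indicator-≡-≤1 r (β x)))
    (≤-reflexive (*-identityˡ _))

-- Removing one element from a list.

module _ {X : Set} where

  length-removeAt-index : {P : X → Set} (xs : List X) (i : Any P xs) → length xs ≡ suc (length (xs ─ i))
  length-removeAt-index xs i = List.length-removeAt′ xs (index i)

  ∈-─⁻ : {P : X → Set} {xs : List X} (i : Any P xs) {y : X} → y ∈ (xs ─ i) → y ∈ xs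
  ∈-─⁻ (here _)  y∈         = there y∈
  ∈-─⁻ (there i) (here eq)  = here eq
  ∈-─⁻ (there i) (there y∈) = there (∈-─⁻ i y∈)

  ∈-─⁺ : {xs : List X} {x y : X} (i : x ∈ xs) → y ∈ xs → y ≢ x → y ∈ (xs ─ i)
  ∈-─⁺ (here refl) (here eq)  y≢x = contradiction eq y≢x
  ∈-─⁺ (here refl) (there y∈) y≢x = y∈
  ∈-─⁺ (there i)   (here eq)  y≢x = here eq
  ∈-─⁺ (there i)   (there y∈) y≢x = there (∈-─⁺ i y∈ y≢x)

  AllPairs-─ : {R : X → X → Set} {P : X → Set} {xs : List X} (i : Any P xs) →
    AllPairs R xs → AllPairs R (xs ─ i)
  AllPairs-─ (here _)  (_ ∷ ps) = ps
  AllPairs-─ (there i) (p ∷ ps) = All.tabulate (λ y∈ → All.lookup p (∈-─⁻ i y∈)) ∷ AllPairs-─ i ps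

  Unique-⊆⇒length-≤ : {xs ys : List X} → Unique xs → (∀ {x} → x ∈ xs → x ∈ ys) → length xs ≤ length ys
  Unique-⊆⇒length-≤ {[]}     _          _   = z≤n
  Unique-⊆⇒length-≤ {x ∷ xs} {ys} (x∉ ∷ u) sub = ≤-trans
    (s≤s (Unique-⊆⇒length-≤ u λ y∈ → ∈-─⁺ x∈ys (sub (there y∈)) (λ y≡x → All.lookup x∉ y∈ (sym y≡x))))
    (≤-reflexive (sym (length-removeAt-index ys x∈ys)))
    where x∈ys = sub (here refl)


-- Windows of integers and their blocks.

Window : ℕ → ℕ → ℕ → Set
Window lo w i = lo ≤ i × i < lo + w

module _ (lo w : ℕ) .{{_ : NonZero w}} where

  -- Truncated subtraction puts everything below `lo` into block 0, hence `lo ≤ i` is assumed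
  -- wherever a window is recovered from a block number.
  block : ℕ → ℕ
  block i = (i ∸ lo) / w

  block-< : ∀ r {i} → Window lo (r * w) i → block i < r
  block-< r {i} (lo≤i , i<) = m<n*o⇒m/o<n
    (+-cancelˡ-< lo _ _ (subst (_< lo + r * w) (sym (m+[n∸m]≡n lo≤i)) i<))

  block-reflects-< : ∀ {i i′} → block i < block i′ → i < i′
  block-reflects-< b< = ≰⇒> λ i′≤i → <⇒≱ b< (/-monoˡ-≤ w (∸-monoˡ-≤ lo i′≤i))

  block-window : ∀ {i} → lo ≤ i → Window (lo + block i * w) w i
  block-window {i} lo≤i = lower , upper
    where
    open ≤-Reasoning
    lower : lo + block i * w ≤ i
    lower = begin
      lo + block i * w  ≤⟨ +-monoʳ-≤ lo (m/n*n≤m (i ∸ lo) w) ⟩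
      lo + (i ∸ lo)     ≡⟨ m+[n∸m]≡n lo≤i ⟩
      i                 ∎
    upper : i < lo + block i * w + w
    upper = begin-strict
      i                        ≡⟨ m+[n∸m]≡n lo≤i ⟨
      lo + (i ∸ lo)            <⟨ +-monoʳ-< lo (begin-strict
        i ∸ lo                   ≡⟨ m≡m%n+[m/n]*n (i ∸ lo) w ⟩
        _ + block i * w          <⟨ +-monoˡ-< (block i * w) (m%n<n (i ∸ lo) w) ⟩
        w + block i * w          ≡⟨ +-comm w _ ⟩
        block i * w + w          ∎) ⟩
      lo + (block i * w + w)   ≡⟨ +-assoc lo _ w ⟨
      lo + block i * w + w     ∎

  fibre-window : ∀ {i b} → lo ≤ i → block i ≡ b → Window (lo + b * w) w i
  fibre-window lo≤i refl = block-window lo≤i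

-- Patterns in lists of entries, and separation of row ranges.

Entry : Set
Entry = ℕ × ℕ

module Pattern {l k : ℕ} (P : Matrix l k) where

  -- The matrix is represented by the list of positions of its ones, so that restricting it to a
  -- window needs no reindexing. Every chosen row and column must occur in `E`, even where `P` has
  -- an empty row or column; this keeps the indices within the matrix when returning to `_≺_`.
  Contains : List Entry → Set
  Contains E = Σ (Fin l → ℕ) λ f → Σ (Fin k → ℕ) λ g →
    (∀ x x′ → toℕ x < toℕ x′ → f x < f x′) × (∀ y y′ → toℕ y < toℕ y′ → g y < g y′) ×
    (∀ x → ∃ λ c → (f x , c) ∈ E) × (∀ y → ∃ λ i → (i , g y) ∈ E) ×
    (∀ x y → P x y ≡ true → (f x , g y) ∈ E)

  Contains-mono : ∀ {E E′} → (∀ {e} → e ∈ E → e ∈ E′) → Contains E → Contains E′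
  Contains-mono sub (f , g , incf , incg , rows , columns , match) =
    f , g , incf , incg , (λ x → proj₁ (rows x) , sub (proj₂ (rows x))) ,
    (λ y → proj₁ (columns y) , sub (proj₂ (columns y))) , λ x y one → sub (match x y one)

  Between : ℕ → ℕ → Fin l → Set
  Between p q x = p ≤ toℕ x × toℕ x < q

  ZeroOn : ℕ → ℕ → Fin k → Set
  ZeroOn p q y = ∀ x → Between p q x → P x y ≡ false

  -- Vertical separability of the rows from `p` up to but excluding `q`, with the cut counted from
  -- the top of `P` and the possible exception named as `y₀`.
  Separation : ℕ → ℕ → Set
  Separation p q = Σ ℕ λ a → p < a × a < q ×
    Σ (Fin k) λ y₀ → ∀ y → y ≢ y₀ → ZeroOn p a y ⊎ ZeroOn a q y

  ColumnSplits? : ∀ {l′} (Q : Matrix l′ k) a y → Dec (ColumnSplits Q a y)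
  ColumnSplits? Q a y =
    Fin.all? (λ x → (toℕ x <? a) →-dec (Q x y Bool.≟ false)) ⊎-dec
    Fin.all? (λ x → (a ≤? toℕ x) →-dec (Q x y Bool.≟ false))

  -- Splitting is decidable, so a search turns the pairwise condition into one named exception. If
  -- every column splits, the arbitrary `y*` serves.
  exceptional-column : ∀ {l′} (Q : Matrix l′ k) a → Fin k →
    (∀ y y′ → y ≢ y′ → ColumnSplits Q a y ⊎ ColumnSplits Q a y′) →
    Σ (Fin k) λ y₀ → ∀ y → y ≢ y₀ → ColumnSplits Q a y
  exceptional-column Q a y* pairs with Fin.any? (λ y → ¬? (ColumnSplits? Q a y))
  ... | no  none      = y* , λ y _ → decidable-stable (ColumnSplits? Q a y) (λ ¬s → none (y , ¬s))
  ... | yes (y₀ , ¬s) = y₀ , λ y y≢ → [ id , (λ s → contradiction s ¬s) ]′ (pairs y y₀ y≢)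

  module _ (degenerate : VerticallyDegenerate P) (y* : Fin k) where

    -- Degeneracy is applied to consecutive rows with all columns. Writing their number as
    -- `suc (suc s)` excludes the single-row alternative.
    separate : ∀ p s → p + suc (suc s) ≤ l → Separation p (p + suc (suc s))
    separate p s q≤l = go (degenerate l′ k r id r-inc (λ _ _ → id) (s≤s z≤n))
      where
      l′ = suc (suc s)
      q = p + l′

      r< : (x : Fin l′) → p + toℕ x < l
      r< x = <-≤-trans (+-monoʳ-< p (Fin.toℕ<n x)) q≤l

      r : Fin l′ → Fin l
      r x = fromℕ< (r< x)

      toℕ-r : ∀ x → toℕ (r x) ≡ p + toℕ x
      toℕ-r x = Fin.toℕ-fromℕ< (r< x)

      r-inc : StrictlyIncreasing r
      r-inc i j i<j = subst₂ _<_ (sym (toℕ-r i)) (sym (toℕ-r j)) (+-monoʳ-< p i<j)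

      preimage : ∀ x → Between p q x → Σ (Fin l′) λ x′ → r x′ ≡ x × p + toℕ x′ ≡ toℕ x
      preimage x (p≤x , x<q) = x′ , Fin.toℕ-injective (trans (toℕ-r x′) p+x′≡x) , p+x′≡x
        where
        x∸p< : toℕ x ∸ p < l′
        x∸p< = +-cancelˡ-< p _ _ (subst (_< q) (sym (m+[n∸m]≡n p≤x)) x<q)
        x′ = fromℕ< x∸p<
        p+x′≡x : p + toℕ x′ ≡ toℕ x
        p+x′≡x = trans (cong (p +_) (Fin.toℕ-fromℕ< x∸p<)) (m+[n∸m]≡n p≤x)

      transfer : ∀ a y → a < l′ → ColumnSplits (submatrix P r id) a y → ZeroOn p (p + a) y ⊎ ZeroOn (p + a) q y
      transfer a y a<l′ (inj₁ top) = inj₁ λ x (p≤x , x<) →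
        let x′ , rx′ , eq = preimage x (p≤x , <-trans x< (+-monoʳ-< p a<l′)) in
        subst (λ z → P z y ≡ false) rx′ (top x′ (+-cancelˡ-< p _ _ (subst (_< p + a) (sym eq) x<)))
      transfer a y a<l′ (inj₂ bot) = inj₂ λ x (≤x , x<) →
        let x′ , rx′ , eq = preimage x (≤-trans (m≤m+n p a) ≤x , x<) in
        subst (λ z → P z y ≡ false) rx′ (bot x′ (+-cancelˡ-≤ p _ _ (subst (p + a ≤_) (sym eq) ≤x)))

      go : l′ ≡ 1 ⊎ VerticallySeparable (submatrix P r id) → Separation p q
      go (inj₂ (a , 1≤a , a<l′ , pairs)) with exceptional-column (submatrix P r id) a y* pairs
      ... | y₀ , split = p + a , subst (_< p + a) (+-identityʳ p) (+-monoʳ-< p 1≤a) , +-monoʳ-< p a<l′ ,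
                         y₀ , λ y y≢ → transfer a y a<l′ (split y y≢)

  -- Tuples and the embeddings of row ranges built from them.

  Tuple : Set
  Tuple = ℕ × (Fin k → ℕ)

  row : Tuple → ℕ
  row = proj₁

  cols : Tuple → Fin k → ℕ
  cols = proj₂

  entry : Fin k → Tuple → Entry
  entry y T = row T , cols T y

  -- For each fixed `y`, pairwise distinct tuples have different `y`-entries, so counting these
  -- entries counts the tuples.
  Distinct : Tuple → Tuple → Set
  Distinct T T′ = ∀ y → entry y T ≢ entry y T′

  Distinct-sym : ∀ {T T′} → Distinct T T′ → Distinct T′ T
  Distinct-sym d y eq = d y (sym eq)

  -- A copy of rows `p` to `q - 1` of `P` with each row inside one tuple and the columns in no
  -- prescribed order. `tuple` is total but constrained only on these rows. `supported` makes
  -- `col y` the `y`-th column of a tuple in use: this yields rooted tuples, and later places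
  -- `col y` in the `y`-th block.
  record Embedding (p q : ℕ) (F : List Tuple) : Set where
    field
      tuple     : Fin l → Tuple
      col       : Fin k → ℕ
      tuple∈    : ∀ x → Between p q x → tuple x ∈ F
      row-mono  : ∀ x x′ → Between p q x → Between p q x′ → toℕ x < toℕ x′ → row (tuple x) < row (tuple x′)
      match     : ∀ x y → Between p q x → P x y ≡ true → cols (tuple x) y ≡ col y
      supported : ∀ y → Σ (Fin l) λ x → Between p q x × cols (tuple x) y ≡ col y

  open Embedding

  embed-row : ∀ p → p < l → ∀ {F T} → T ∈ F → Embedding p (suc p) F
  embed-row p p<l {T = T} T∈F = record
    { tuple     = λ _ → T
    ; col       = cols T
    ; tuple∈    = λ _ _ → T∈F
    ; row-mono  = λ x x′ (p≤x , _) (_ , x′<) x<x′ → 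
        contradiction (≤-trans (≤-trans (s≤s p≤x) x<x′) (s≤s⁻¹ x′<)) (<-irrefl refl)
    ; match     = λ _ _ _ _ → refl
    ; supported = λ y → fromℕ< p<l , (≤-reflexive (sym (Fin.toℕ-fromℕ< p<l)) , s≤s (≤-reflexive (Fin.toℕ-fromℕ< p<l))) , refl
    }

  module _ {p a q : ℕ} {F F₁ F₂ : List Tuple} (p<a : p < a) (a<q : a < q)
           (F₁⊆F : ∀ {T} → T ∈ F₁ → T ∈ F) (F₂⊆F : ∀ {T} → T ∈ F₂ → T ∈ F)
           (above : ∀ {T T′} → T ∈ F₁ → T′ ∈ F₂ → row T < row T′)
           {y₀ : Fin k} (split : ∀ y → y ≢ y₀ → ZeroOn p a y ⊎ ZeroOn a q y) where

    -- A column other than `y₀` is zero on one side of the cut, so its image can be taken from the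
    -- copy on the other side. Only at `y₀` must the two copies agree.
    glue : (ε₁ : Embedding p a F₁) (ε₂ : Embedding a q F₂) → col ε₁ y₀ ≡ col ε₂ y₀ → Embedding p q F
    glue ε₁ ε₂ agree = record
      { tuple     = tup
      ; col       = λ y → proj₁ (column y)
      ; tuple∈    = tup∈
      ; row-mono  = mono
      ; match     = λ x y → proj₁ (proj₂ (column y)) x
      ; supported = λ y → proj₂ (proj₂ (column y))
      }
      where
      tup : Fin l → Tuple
      tup x with toℕ x <? a
      ... | yes _ = tuple ε₁ x
      ... | no  _ = tuple ε₂ x

      tup₁ : ∀ x → toℕ x < a → tup x ≡ tuple ε₁ x
      tup₁ x x<a with toℕ x <? a
      ... | yes _   = refl
      ... | no  x≮a = contradiction x<a x≮a

      tup₂ : ∀ x → a ≤ toℕ x → tup x ≡ tuple ε₂ x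
      tup₂ x a≤x with toℕ x <? a
      ... | yes x<a = contradiction a≤x (<⇒≱ x<a)
      ... | no  _   = refl

      tup∈ : ∀ x → Between p q x → tup x ∈ F
      tup∈ x (p≤x , x<q) with toℕ x <? a
      ... | yes x<a = F₁⊆F (tuple∈ ε₁ x (p≤x , x<a))
      ... | no  x≮a = F₂⊆F (tuple∈ ε₂ x (≮⇒≥ x≮a , x<q))

      mono : ∀ x x′ → Between p q x → Between p q x′ → toℕ x < toℕ x′ → row (tup x) < row (tup x′)
      mono x x′ (p≤x , x<q) (p≤x′ , x′<q) x<x′ with toℕ x <? a | toℕ x′ <? a
      ... | yes x<a | yes x′<a = row-mono ε₁ x x′ (p≤x , x<a) (p≤x′ , x′<a) x<x′
      ... | yes x<a | no  x′≮a = above (tuple∈ ε₁ x (p≤x , x<a)) (tuple∈ ε₂ x′ (≮⇒≥ x′≮a , x′<q))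
      ... | no  x≮a | yes x′<a = contradiction (<-trans x<x′ x′<a) x≮a
      ... | no  x≮a | no  x′≮a = row-mono ε₂ x x′ (≮⇒≥ x≮a , x<q) (≮⇒≥ x′≮a , x′<q) x<x′

      Column : Fin k → Set
      Column y = Σ ℕ λ c → (∀ x → Between p q x → P x y ≡ true → cols (tup x) y ≡ c) ×
                           Σ (Fin l) λ x → Between p q x × cols (tup x) y ≡ c

      support₁ : ∀ y → Σ (Fin l) λ x → Between p q x × cols (tup x) y ≡ col ε₁ y
      support₁ y with supported ε₁ y
      ... | x , (p≤x , x<a) , eq = x , (p≤x , <-trans x<a a<q) , trans (cong (λ T → cols T y) (tup₁ x x<a)) eq

      support₂ : ∀ y → Σ (Fin l) λ x → Between p q x × cols (tup x) y ≡ col ε₂ y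
      support₂ y with supported ε₂ y
      ... | x , (a≤x , x<q) , eq = x , (≤-trans (<⇒≤ p<a) a≤x , x<q) , trans (cong (λ T → cols T y) (tup₂ x a≤x)) eq

      column : ∀ y → Column y
      column y with y Fin.≟ y₀
      ... | yes refl = col ε₁ y , matches , support₁ y
        where
        matches : ∀ x → Between p q x → P x y ≡ true → cols (tup x) y ≡ col ε₁ y
        matches x b one with toℕ x <? a
        ... | yes x<a = match ε₁ x y (proj₁ b , x<a) one
        ... | no  x≮a = trans (match ε₂ x y (≮⇒≥ x≮a , proj₂ b) one) (sym agree)
      ... | no y≢ with split y y≢
      ...   | inj₂ zero-below = col ε₁ y , matches , support₁ y
        where
        matches : ∀ x → Between p q x → P x y ≡ true → cols (tup x) y ≡ col ε₁ y
        matches x b one with toℕ x <? a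
        ... | yes x<a = match ε₁ x y (proj₁ b , x<a) one
        ... | no  x≮a = contradiction (trans (sym one) (zero-below x (≮⇒≥ x≮a , proj₂ b))) λ ()
      ...   | inj₁ zero-above = col ε₂ y , matches , support₂ y
        where
        matches : ∀ x → Between p q x → P x y ≡ true → cols (tup x) y ≡ col ε₂ y
        matches x b one with toℕ x <? a
        ... | yes x<a = contradiction (trans (sym one) (zero-above x (proj₁ b , x<a))) λ ()
        ... | no  x≮a = match ε₂ x y (≮⇒≥ x≮a , proj₂ b) one

-- Peels off good elements one at a time, so that badness need not be decidable.
refine : {X : Set} {R : X → X → Set} → (∀ {x y} → R x y → R y x) → (Good : X → Set) (c W : ℕ) (F : List X) →
  (∀ F′ → (∀ {x} → x ∈ F′ → x ∈ F) → AllPairs R F′ → W < c * length F′ → Σ X λ x → x ∈ F′ × Good x) →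
  AllPairs R F →
  Σ (List X) λ G → (∀ {x} → x ∈ G → x ∈ F) × AllPairs R G × (∀ {x} → x ∈ G → Good x) ×
    c * length F ≤ c * length G + W
refine {X} {R} R-sym Good c W F find-good = go (length F) F refl id
  where
  go : ∀ n F′ → length F′ ≡ n → (∀ {x} → x ∈ F′ → x ∈ F) → AllPairs R F′ →
    Σ (List X) λ G → (∀ {x} → x ∈ G → x ∈ F′) × AllPairs R G × (∀ {x} → x ∈ G → Good x) ×
      c * length F′ ≤ c * length G + W
  go n F′ len sub pairs with W <? c * length F′
  ... | no  ≮W = [] , (λ ()) , [] , (λ ()) , ≤-trans (≮⇒≥ ≮W) (m≤n+m W (c * 0))
  ... | yes <W with find-good F′ sub pairs <W
  go zero    []       len sub pairs | yes _ | _ , () , _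
  go (suc n) F′@(_ ∷ _) len sub pairs | yes <W | x , x∈ , good
    with go n (F′ ─ x∈) (suc-injective (trans (sym (length-removeAt-index F′ x∈)) len))
            (λ y∈ → sub (∈-─⁻ x∈ y∈)) (AllPairs-─ x∈ pairs)
  ... | G , G⊆ , G-pairs , G-good , bound =
    x ∷ G , (λ { (here refl) → x∈ ; (there y∈) → ∈-─⁻ x∈ (G⊆ y∈) }) ,
    All.tabulate (λ y∈ → removed x∈ pairs (G⊆ y∈)) ∷ G-pairs ,
    (λ { (here refl) → good ; (there y∈) → G-good y∈ }) ,
    (begin
      c * length F′                    ≡⟨ cong (c *_) (length-removeAt-index F′ x∈) ⟩
      c * suc (length (F′ ─ x∈))       ≡⟨ *-suc c _ ⟩
      c + c * length (F′ ─ x∈)         ≤⟨ +-monoʳ-≤ c bound ⟩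
      c + (c * length G + W)           ≡⟨ +-assoc c _ W ⟨
      c + c * length G + W             ≡⟨ cong (_+ W) (*-suc c (length G)) ⟨
      c * length (x ∷ G) + W           ∎)
    where
    open ≤-Reasoning
    removed : ∀ {xs x y} (i : x ∈ xs) → AllPairs R xs → y ∈ (xs ─ i) → R x y
    removed (here refl) (p ∷ _)  y∈          = All.lookup p y∈
    removed (there i)   (p ∷ _)  (here refl) = R-sym (All.lookup p i)
    removed (there i)   (_ ∷ ps) (there y∈)  = removed i ps y∈

-- Dense families of tuples contain the pattern up to column order.

module Density {l k : ℕ} (P : Matrix l k) (degenerate : VerticallyDegenerate P) (y* : Fin k)
               (R : ℕ) {{R≢0 : NonZero R}} where

  open Pattern P
  open Embedding

  -- The recursion hypothesis for windows of `R ^ a` rows. Measuring size by the lists `Rs` and `Cs`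
  -- of admissible lines lets the bounds for several windows add up when their lines are disjoint.
  Bounded : ℕ → List Entry → ℕ → Set
  Bounded V E a = ∀ E′ → Unique E′ → (∀ {e} → e ∈ E′ → e ∈ E) → ∀ Rs Cs lo →
    (∀ {e} → e ∈ E′ → proj₁ e ∈ Rs × proj₂ e ∈ Cs × Window lo (R ^ a) (proj₁ e)) →
    length E′ ≤ V * (length Rs + length Cs) * 2 ^ a

  Embedding-mono : ∀ {p q F F′} → (∀ {T} → T ∈ F → T ∈ F′) → Embedding p q F → Embedding p q F′
  Embedding-mono sub ε = record
    { tuple = tuple ε ; col = col ε ; tuple∈ = λ x b → sub (tuple∈ ε x b)
    ; row-mono = row-mono ε ; match = match ε ; supported = supported ε }

  module Cut {V a′ lo p a₀ q : ℕ} {E : List Entry} {Rs Cs : List ℕ} {F : List Tuple} {y₀ : Fin k}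
             (r D : ℕ) {{r≢0 : NonZero r}} (w : ℕ) {{w≢0 : NonZero w}} (w≡ : w ≡ R ^ a′)
             (bounded : Bounded V E a′)
             (E⊆ : ∀ {e} → e ∈ E → proj₁ e ∈ Rs × proj₂ e ∈ Cs)
             (p<a₀ : p < a₀) (a₀<q : a₀ < q)
             (split : ∀ y → y ≢ y₀ → ZeroOn p a₀ y ⊎ ZeroOn a₀ q y)
             (F⊆E : ∀ {T} → T ∈ F → ∀ y → entry y T ∈ E)
             (F-in : ∀ {T} → T ∈ F → Window lo (r * w) (row T)) where

    blk : ℕ → ℕ
    blk = block lo w

    part : ℕ → List Tuple
    part b = filter (λ T → blk (row T) ≟ b) F

    part⁻ : ∀ b {T} → T ∈ part b → T ∈ F × blk (row T) ≡ b
    part⁻ b = ∈-filter⁻ (λ T → blk (row T) ≟ b)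

    part-window : ∀ b {T} → T ∈ part b → Window (lo + b * w) (R ^ a′) (row T)
    part-window b T∈ with part⁻ b T∈
    ... | T∈F , eq = subst (λ z → Window (lo + b * w) z _) w≡ (fibre-window lo w (proj₁ (F-in T∈F)) eq)

    -- Only the column of the `y₀`-entry is tied to the copy, since `glue` asks for agreement in
    -- that column alone.
    Rooted : ℕ → ℕ → ℕ → Tuple → Set
    Rooted b p q T = Σ (Embedding p q (part b)) λ ε → cols T y₀ ≡ col ε y₀

    W′ : ℕ
    W′ = V * (length Rs + length Cs) * 2 ^ a′

    module Selected (G : ℕ → List Tuple)
                    (G⊆part : ∀ b {T} → T ∈ G b → T ∈ part b)
                    (G! : ∀ b → AllPairs Distinct (G b))
                    (G-good : ∀ b {T} → T ∈ G b → Rooted b p a₀ T × Rooted b a₀ q T)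
                    -- Passing from `part b` to `G b` may lose `W′` once for the upper and once for
                    -- the lower half of the pattern.
                    (G-large : ∀ b → D * r * length (part b) ≤ D * r * length (G b) + (W′ + W′)) where

      G⊆F : ∀ b {T} → T ∈ G b → T ∈ F
      G⊆F b T∈ = proj₁ (part⁻ b (G⊆part b T∈))

      meets? : ∀ b c → Dec (Any (λ T → cols T y₀ ≡ c) (G b))
      meets? b c = any? (λ T → cols T y₀ ≟ c) (G b)

      -- The upper half is taken from the earlier window and the lower half from the later one; both
      -- copies send `y₀` to `c`.
      join : ∀ {c b b′} → b < b′ → Any (λ T → cols T y₀ ≡ c) (G b) → Any (λ T → cols T y₀ ≡ c) (G b′) →
        Embedding p q F
      join {b = b} {b′} b<b′ m m′ with find m | find m′
      ... | T , T∈ , eq | T′ , T′∈ , eq′ with proj₁ (G-good b T∈) | proj₂ (G-good b′ T′∈)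
      ...   | ε₁ , eq₁ | ε₂ , eq₂ =
        glue p<a₀ a₀<q (proj₁ ∘ part⁻ b) (proj₁ ∘ part⁻ b′)
          (λ T∈ T′∈ → block-reflects-< lo w
             (subst₂ _<_ (sym (proj₂ (part⁻ b T∈))) (sym (proj₂ (part⁻ b′ T′∈))) b<b′))
          split ε₁ ε₂ (trans (sym eq₁) (trans eq (trans (sym eq′) eq₂)))

      Rs′ Cs′ : ℕ → List ℕ
      Rs′ b = filter (λ i → blk i ≟ b) Rs
      Cs′ b = filter (meets? b) Cs

      -- The `y₀`-entries of `G b` are distinct, lie in the rows of window `b`, and use only columns
      -- that `G b` meets, so the recursion hypothesis applies with these shorter lists of lines.
      G-bound : ∀ b → length (G b) ≤ V * (length (Rs′ b) + length (Cs′ b)) * 2 ^ a′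
      G-bound b = subst (_≤ V * (length (Rs′ b) + length (Cs′ b)) * 2 ^ a′) (List.length-map (entry y₀) (G b))
        (bounded (map (entry y₀) (G b)) unique sub (Rs′ b) (Cs′ b) (lo + b * w) located)
        where
        unique : Unique (map (entry y₀) (G b))
        unique = AllPairs.map⁺ (AllPairs.map (λ d → d y₀) (G! b))
        sub : ∀ {e} → e ∈ map (entry y₀) (G b) → e ∈ E
        sub e∈ with ∈-map⁻ (entry y₀) e∈
        ... | T , T∈ , refl = F⊆E (G⊆F b T∈) y₀
        located : ∀ {e} → e ∈ map (entry y₀) (G b) →
          proj₁ e ∈ Rs′ b × proj₂ e ∈ Cs′ b × Window (lo + b * w) (R ^ a′) (proj₁ e)
        located e∈ with ∈-map⁻ (entry y₀) e∈
        ... | T , T∈ , refl with E⊆ (F⊆E (G⊆F b T∈) y₀)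
        ...   | i∈ , c∈ =
          ∈-filter⁺ (λ i → blk i ≟ b) i∈ (proj₂ (part⁻ b (G⊆part b T∈))) ,
          ∈-filter⁺ (meets? b) c∈ (lose T∈ refl) ,
          part-window b (G⊆part b T∈)

      -- If two windows meet a common column, `join` applies. Otherwise the lists `Cs′ b` are
      -- disjoint, so all the `G b` together have at most `W′` tuples, with no factor `r`. The
      -- losses of `2 W′` in each of `r` windows carry weight `D * r`, so after cancelling `r` they
      -- add only `2 W′`.
      embedding-or-bound : Embedding p q F ⊎ D * length F ≤ (D + 2) * W′
      embedding-or-bound with any? (λ c → 2 ≤? ∑ r (λ b → indicator (meets? b c))) Cs
      ... | yes some with find some
      ...   | c , _ , ≥2 with ∑-indicator⇒increasing (λ b → meets? b c) r 2 ≥2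
      ...     | f , inc , sat = inj₁ (join (inc zero (suc zero) z<s) (proj₁ (sat zero)) (proj₁ (sat (suc zero))))
      embedding-or-bound | no none = inj₂ (*-cancelˡ-≤ r scaled)
        where
        open ≤-Reasoning

        Cs-bound : ∑ r (λ b → length (Cs′ b)) ≤ length Cs
        Cs-bound = ≤-trans
          (∑-length-filter-≤ meets? r 1 Cs (All.map (λ ≱2 → s≤s⁻¹ (≰⇒> ≱2)) (All.¬Any⇒All¬ Cs none)))
          (≤-reflexive (*-identityˡ _))

        ∑G-bound : ∑ r (λ b → length (G b)) ≤ W′
        ∑G-bound = begin
          ∑ r (λ b → length (G b))
            ≤⟨ ∑-mono-≤ r (λ b _ → ≤-trans (G-bound b) (≤-reflexive (swap V _ (2 ^ a′)))) ⟩
          ∑ r (λ b → V * 2 ^ a′ * (length (Rs′ b) + length (Cs′ b)))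
            ≡⟨ ∑-*ˡ r (V * 2 ^ a′) (λ b → length (Rs′ b) + length (Cs′ b)) ⟩
          V * 2 ^ a′ * ∑ r (λ b → length (Rs′ b) + length (Cs′ b))
            ≡⟨ cong (V * 2 ^ a′ *_) (∑-+ r (length ∘ Rs′) (length ∘ Cs′)) ⟩
          V * 2 ^ a′ * (∑ r (length ∘ Rs′) + ∑ r (length ∘ Cs′))
            ≤⟨ *-monoʳ-≤ (V * 2 ^ a′) (+-mono-≤ (∑-fibres-≤-length blk r Rs) Cs-bound) ⟩
          V * 2 ^ a′ * (length Rs + length Cs)
            ≡⟨ swap V _ (2 ^ a′) ⟨
          W′ ∎
          where
          swap : ∀ v x t → v * x * t ≡ v * t * x
          swap = solve-∀

        scaled : r * (D * length F) ≤ r * ((D + 2) * W′)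
        scaled = begin
          r * (D * length F)                                  ≡⟨ reorder r D (length F) ⟩
          D * r * length F                                       ≤⟨ *-monoʳ-≤ (D * r) (length-≤-∑-fibres (blk ∘ row) r F (λ T∈ → block-< lo w r (F-in T∈))) ⟩
          D * r * ∑ r (length ∘ part)                            ≡⟨ ∑-*ˡ r (D * r) (length ∘ part) ⟨
          ∑ r (λ b → D * r * length (part b))                    ≤⟨ ∑-mono-≤ r (λ b _ → G-large b) ⟩
          ∑ r (λ b → D * r * length (G b) + (W′ + W′))           ≡⟨ ∑-+ r (λ b → D * r * length (G b)) (λ _ → W′ + W′) ⟩
          ∑ r (λ b → D * r * length (G b)) + ∑ r (λ _ → W′ + W′) ≡⟨ cong₂ _+_ (∑-*ˡ r (D * r) (length ∘ G)) (∑-const r (W′ + W′)) ⟩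
          D * r * ∑ r (length ∘ G) + r * (W′ + W′)               ≤⟨ +-monoˡ-≤ _ (*-monoʳ-≤ (D * r) ∑G-bound) ⟩
          D * r * W′ + r * (W′ + W′)                             ≡⟨ collect D r W′ ⟩
          r * ((D + 2) * W′)                                  ∎
          where
          reorder : ∀ r d f → r * (d * f) ≡ d * r * f
          reorder = solve-∀
          collect : ∀ d r w → d * r * w + r * (w + w) ≡ r * ((d + 2) * w)
          collect = solve-∀

  -- The induction statement for at most `s` rows of `P`: a family exceeding a `1 / D` fraction of
  -- the recursion bound contains them. `H` is the exponent from which the window is high enough for
  -- all the cuts still to come.
  Dense⇒Embedding : ℕ → ℕ → ℕ → Set
  Dense⇒Embedding s D H = ∀ a → H ≤ a → ∀ V E Rs Cs →
    (∀ a′ → a′ < a → Bounded V E a′) →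
    (∀ {e} → e ∈ E → proj₁ e ∈ Rs × proj₂ e ∈ Cs) →
    ∀ p q → p < q → q ≤ p + s → q ≤ l → ∀ F lo → AllPairs Distinct F →
    (∀ {T} → T ∈ F → ∀ y → entry y T ∈ E) → (∀ {T} → T ∈ F → Window lo (R ^ a) (row T)) →
    V * (length Rs + length Cs) * 2 ^ a < D * length F → Embedding p q F

  module Step (s D h r a′ H′ : ℕ) (h≡ : h ≡ D + 2) (r≡ : r ≡ R ^ h) {{r≢0 : NonZero r}}
              (IH : Dense⇒Embedding s (D * r) H′) (H′≤a′ : H′ ≤ a′)
              (V : ℕ) (E : List Entry) (Rs Cs : List ℕ) (bounded : ∀ a″ → a″ < h + a′ → Bounded V E a″)
              (E⊆ : ∀ {e} → e ∈ E → proj₁ e ∈ Rs × proj₂ e ∈ Cs)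
              (p q : ℕ) (q≤p+s : q ≤ p + suc s) (q≤l : q ≤ l) (separation : Separation p q)
              (F : List Tuple) (lo : ℕ) (F! : AllPairs Distinct F)
              (F⊆E : ∀ {T} → T ∈ F → ∀ y → entry y T ∈ E)
              (F-window : ∀ {T} → T ∈ F → Window lo (R ^ (h + a′)) (row T)) where

    a₀ : ℕ
    a₀ = proj₁ separation

    p<a₀ : p < a₀
    p<a₀ = proj₁ (proj₂ separation)

    a₀<q : a₀ < q
    a₀<q = proj₁ (proj₂ (proj₂ separation))

    y₀ : Fin k
    y₀ = proj₁ (proj₂ (proj₂ (proj₂ separation)))

    a′<a : a′ < h + a′
    a′<a = m<n+m a′ (subst (0 <_) (sym h≡) (≤-trans (s≤s z≤n) (m≤n+m 2 D)))

    F-in : ∀ {T} → T ∈ F → Window lo (r * R ^ a′) (row T)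
    F-in T∈ = subst (λ z → Window lo z _)
      (trans (^-distribˡ-+-* R h a′) (cong (_* R ^ a′) (sym r≡))) (F-window T∈)

    instance
      w≢0 : NonZero (R ^ a′)
      w≢0 = m^n≢0 R a′

    open Cut {V} {a′} {lo} {p} {a₀} {q} {E} {Rs} {Cs} {F} {y₀} r D (R ^ a′) refl
             (bounded a′ a′<a) E⊆ p<a₀ a₀<q (proj₂ (proj₂ (proj₂ (proj₂ separation)))) F⊆E F-in

    -- The induction hypothesis, at density `D * r` inside one window, embeds the rows in `F′`. By
    -- `supported`, the column `col ε y₀` belongs to some tuple of `F′`, which is therefore rooted.
    find-rooted : ∀ b p q → p < q → q ≤ p + s → q ≤ l → ∀ F′ → (∀ {T} → T ∈ F′ → T ∈ part b) →
      AllPairs Distinct F′ → W′ < D * r * length F′ → Σ Tuple λ T → T ∈ F′ × Rooted b p q T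
    find-rooted b p q p<q q≤ q≤l F′ F′⊆ F′! large = tuple ε x , tuple∈ ε x btw , Embedding-mono F′⊆ ε , eq
      where
      ε : Embedding p q F′
      ε = IH a′ H′≤a′ V E Rs Cs (λ a″ a″<a′ → bounded a″ (<-trans a″<a′ a′<a)) E⊆
            p q p<q q≤ q≤l F′ (lo + b * R ^ a′) F′!
            (λ T∈ → F⊆E (proj₁ (part⁻ b (F′⊆ T∈)))) (λ T∈ → part-window b (F′⊆ T∈)) large
      x = proj₁ (supported ε y₀)
      btw = proj₁ (proj₂ (supported ε y₀))
      eq = proj₂ (proj₂ (supported ε y₀))

    -- Since `a₀` lies strictly between `p` and `q`, both halves have at most `s` rows and
    -- `find-rooted` serves for each.
    select : ∀ b → Σ (List Tuple) λ G → (∀ {T} → T ∈ G → T ∈ part b) × AllPairs Distinct G ×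
      (∀ {T} → T ∈ G → Rooted b p a₀ T × Rooted b a₀ q T) × D * r * length (part b) ≤ D * r * length G + (W′ + W′)
    select b
      with refine (λ {T} {T′} → Distinct-sym {T} {T′}) (Rooted b p a₀) (D * r) W′ (part b)
             (find-rooted b p a₀ p<a₀ (s≤s⁻¹ (≤-trans a₀<q (≤-trans q≤p+s (≤-reflexive (+-suc p s)))))
                          (≤-trans (<⇒≤ a₀<q) q≤l))
             (AllPairs.filter⁺ (λ T → blk (row T) ≟ b) F!)
    ... | G₁ , G₁⊆ , G₁! , G₁-good , bound₁
      -- The second refinement starts from the survivors of the first, so that `G₂` roots both
      -- copies.
      with refine (λ {T} {T′} → Distinct-sym {T} {T′}) (Rooted b a₀ q) (D * r) W′ G₁
             (λ F′ F′⊆ → find-rooted b a₀ q a₀<q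
                           (≤-trans q≤p+s (≤-trans (≤-reflexive (+-suc p s)) (+-monoˡ-≤ s p<a₀)))
                           q≤l F′ (G₁⊆ ∘ F′⊆))
             G₁!
    ... | G₂ , G₂⊆ , G₂! , G₂-good , bound₂ =
      G₂ , G₁⊆ ∘ G₂⊆ , G₂! , (λ T∈ → G₁-good (G₂⊆ T∈) , G₂-good T∈) ,
      ≤-trans bound₁ (≤-trans (+-monoˡ-≤ W′ bound₂) (≤-reflexive (+-assoc _ W′ W′)))

    embedding : V * (length Rs + length Cs) * 2 ^ (h + a′) < D * length F → Embedding p q F
    embedding large = [ id , (λ small → contradiction large (≤⇒≯ (≤-trans small grow))) ]′
      (Selected.embedding-or-bound (λ b → proj₁ (select b)) (λ b → proj₁ (proj₂ (select b)))
        (λ b → proj₁ (proj₂ (proj₂ (select b)))) (λ b → proj₁ (proj₂ (proj₂ (proj₂ (select b)))))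
        (λ b → proj₂ (proj₂ (proj₂ (proj₂ (select b))))))
      where
      open ≤-Reasoning
      n≤2^n : ∀ n → n ≤ 2 ^ n
      n≤2^n zero    = z≤n
      n≤2^n (suc n) = ≤-trans (+-mono-≤ (m^n>0 2 n) (n≤2^n n)) (≤-reflexive (cong (2 ^ n +_) (sym (+-identityʳ _))))
      regroup : ∀ u v t → u * (v * t) ≡ v * (u * t)
      regroup = solve-∀
      -- The reason for `h = D + 2`: raising the exponent by `h` gains the factor `2 ^ h ≥ h`, which
      -- pays for `D + 2`.
      grow : (D + 2) * W′ ≤ V * (length Rs + length Cs) * 2 ^ (h + a′)
      grow = begin
        (D + 2) * W′                                     ≡⟨ cong (_* W′) h≡ ⟨
        h * W′                                           ≤⟨ *-monoˡ-≤ W′ (n≤2^n h) ⟩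
        2 ^ h * W′                                       ≡⟨ regroup (2 ^ h) (V * (length Rs + length Cs)) (2 ^ a′) ⟩
        V * (length Rs + length Cs) * (2 ^ h * 2 ^ a′)   ≡⟨ cong (V * (length Rs + length Cs) *_) (^-distribˡ-+-* 2 h a′) ⟨
        V * (length Rs + length Cs) * 2 ^ (h + a′)       ∎

  -- Cutting into `R ^ (D + 2)` windows lowers the exponent by `D + 2`; the threshold `D + 2 + H′`
  -- leaves at least `H′` for the induction hypothesis.
  step : ∀ s D H′ → Dense⇒Embedding s (D * R ^ (D + 2)) H′ → Dense⇒Embedding (suc s) D (D + 2 + H′)
  step s D H′ IH a H≤a V E Rs Cs bounded E⊆ p q p<q q≤p+s q≤l F lo F! F⊆E F-window large
    with m≤n⇒∃[o]m+o≡n p<q | m≤n⇒∃[o]m+o≡n (≤-trans (m≤m+n (D + 2) H′) H≤a)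
  ... | suc s′ , refl | a′ , refl =
    Step.embedding s D (D + 2) (R ^ (D + 2)) a′ H′ refl refl {{m^n≢0 R (D + 2)}} IH (+-cancelˡ-≤ (D + 2) _ _ H≤a)
      V E Rs Cs bounded E⊆ p q q≤p+s q≤l
      (subst (Separation p) (+-suc p (suc s′))
        (separate degenerate y* p s′ (subst (_≤ l) (sym (+-suc p (suc s′))) q≤l)))
      F lo F! F⊆E F-window large
  -- Here `q = p + 1`: one row is embedded by any tuple, and density excludes an empty family.
  step s D H′ IH a H≤a V E Rs Cs bounded E⊆ p q p<q q≤p+s q≤l (T ∷ F) lo F! F⊆E F-window large | zero , refl | _ =
    subst (λ q → Embedding p q (T ∷ F)) (cong suc (sym (+-identityʳ p)))
      (embed-row p (≤-trans (s≤s (m≤m+n p 0)) q≤l) (here refl))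
  step s D H′ IH a H≤a V E Rs Cs bounded E⊆ p q p<q q≤p+s q≤l [] lo F! F⊆E F-window large | zero , refl | _ =
    contradiction (subst (V * (length Rs + length Cs) * 2 ^ a <_) (*-zeroʳ D) large) λ ()

  dense⇒embedding : ∀ s D → Σ ℕ (Dense⇒Embedding s D)
  dense⇒embedding zero D = 0 , λ a _ V E Rs Cs _ _ p q p<q q≤p+0 →
    contradiction (subst (q ≤_) (+-identityʳ p) q≤p+0) (<⇒≱ p<q)
  dense⇒embedding (suc s) D with dense⇒embedding s (D * R ^ (D + 2))
  ... | H′ , IH = D + 2 + H′ , step s D H′ IH

-- Pigeonhole over the blocks used by a tuple.

average-≤-some : ∀ r (f : ℕ → ℕ) → Σ ℕ λ j → ∑ r f ≤ r * f j
average-≤-some zero    f = 0 , z≤n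
average-≤-some (suc r) f with average-≤-some r (f ∘ suc)
... | j , le with ≤-total (f 0) (f (suc j))
...   | inj₁ f0≤ = suc j , +-mono-≤ f0≤ le
...   | inj₂ ≤f0 = 0 , +-monoʳ-≤ (f 0) (≤-trans le (*-monoʳ-≤ r ≤f0))

-- The most popular value is fixed for one coordinate after another, at the cost of a factor `t`
-- each time.
monochromatic : {X : Set} {R : X → X → Set} (t n : ℕ) (β : Fin n → X → ℕ) (F : List X) →
  (∀ {x} → x ∈ F → ∀ y → β y x < t) → AllPairs R F →
  Σ (List X) λ F′ → Σ (Fin n → ℕ) λ τ → (∀ {x} → x ∈ F′ → x ∈ F) × AllPairs R F′ ×
    (∀ {x} → x ∈ F′ → ∀ y → β y x ≡ τ y) × length F ≤ t ^ n * length F′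
monochromatic t zero    β F β< F! =
  F , (λ ()) , id , F! , (λ _ ()) , ≤-reflexive (sym (*-identityˡ (length F)))
monochromatic {X} t (suc n) β F β< F! with average-≤-some t (λ j → length (filter (λ x → β zero x ≟ j) F))
... | j , avg with monochromatic t n (β ∘ suc) (filter (λ x → β zero x ≟ j) F)
                     (λ x∈ y → β< (proj₁ (∈-filter⁻ (λ x → β zero x ≟ j) x∈)) (suc y))
                     (AllPairs.filter⁺ (λ x → β zero x ≟ j) F!)
...   | F′ , τ , F′⊆ , F′! , mono , large = F′ , τ′ , F′⊆F , F′! , mono′ , (begin
  length F                                            ≤⟨ length-≤-∑-fibres (β zero) t F (λ x∈ → β< x∈ zero) ⟩
  ∑ t (λ j → length (filter (λ x → β zero x ≟ j) F))  ≤⟨ avg ⟩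
  t * length (filter (λ x → β zero x ≟ j) F)          ≤⟨ *-monoʳ-≤ t large ⟩
  t * (t ^ n * length F′)                             ≡⟨ *-assoc t (t ^ n) (length F′) ⟨
  t ^ suc n * length F′                               ∎)
  where
  open ≤-Reasoning
  τ′ : Fin (suc n) → ℕ
  τ′ zero    = j
  τ′ (suc y) = τ y
  F′⊆F : ∀ {x} → x ∈ F′ → x ∈ F
  F′⊆F x∈ = proj₁ (∈-filter⁻ (λ x → β zero x ≟ j) (F′⊆ x∈))
  mono′ : ∀ {x} → x ∈ F′ → ∀ y → β y x ≡ τ′ y
  mono′ x∈ zero    = proj₂ (∈-filter⁻ (λ x → β zero x ≟ j) {xs = F} (F′⊆ x∈))
  mono′ x∈ (suc y) = mono x∈ y

-- Extracting tuples that spread over many column blocks.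

length-filter-complement : {X : Set} {P : X → Set} (P? : Decidable P) (xs : List X) →
  length xs ≡ length (filter P? xs) + length (filter (¬? ∘ P?) xs)
length-filter-complement P? []       = refl
length-filter-complement P? (x ∷ xs) with does (P? x)
... | true  = cong suc (length-filter-complement P? xs)
... | false = trans (cong suc (length-filter-complement P? xs)) (sym (+-suc _ _))

module Extraction {l k : ℕ} (P : Matrix l k) (y* : Fin k) (β : ℕ → ℕ) (t : ℕ) where

  open Pattern P

  Hits : List Entry → ℕ → ℕ → Set
  Hits E j i = Any (λ e → proj₁ e ≡ i × β (proj₂ e) ≡ j) E

  hits? : ∀ E j i → Dec (Hits E j i)
  hits? E j i = any? (λ e → (proj₁ e ≟ i) ×-dec (β (proj₂ e) ≟ j)) E

  Ordered : Tuple → Set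
  Ordered T = ∀ y y′ → toℕ y < toℕ y′ → β (cols T y) < β (cols T y′)

  -- `concentrated` keeps the recursion into blocks cheap: a row has to be passed on to at most `k`
  -- of them.
  record Decomposition (E : List Entry) (Rs : List ℕ) : Set where
    field
      rest         : List Entry
      tuples       : List Tuple
      rest⊆        : ∀ {e} → e ∈ rest → e ∈ E
      rest!        : Unique rest
      tuples⊆      : ∀ {T} → T ∈ tuples → ∀ y → entry y T ∈ E
      tuples!      : AllPairs Distinct tuples
      ordered      : ∀ {T} → T ∈ tuples → Ordered T
      size         : length E ≤ length rest + k * length tuples
      concentrated : All (λ i → ∑ t (λ j → indicator (hits? rest j i)) ≤ k) Rs

  open Decomposition

  module _ (E : List Entry) (T : Tuple) where

    inTuple? : ∀ e → Dec (∃ λ y → e ≡ entry y T)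
    inTuple? e = Fin.any? (λ y → ×.≡-dec _≟_ _≟_ e (entry y T))

    remove : List Entry
    remove = filter (¬? ∘ inTuple?) E

    remove⁻ : ∀ {e} → e ∈ remove → e ∈ E × ¬ (∃ λ y → e ≡ entry y T)
    remove⁻ = ∈-filter⁻ (¬? ∘ inTuple?)

    length-remove : Unique E → length E ≤ length remove + k
    length-remove E! = begin
      length E                                    ≡⟨ length-filter-complement inTuple? E ⟩
      length (filter inTuple? E) + length remove  ≤⟨ +-monoˡ-≤ _ removed ⟩
      k + length remove                           ≡⟨ +-comm k _ ⟩
      length remove + k                           ∎
      where
      open ≤-Reasoning
      removed : length (filter inTuple? E) ≤ k
      removed = ≤-trans
        (Unique-⊆⇒length-≤ (Unique.filter⁺ inTuple? E!) sub)
        (≤-reflexive (List.length-tabulate (λ y → entry y T)))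
        where
        sub : ∀ {e} → e ∈ filter inTuple? E → e ∈ tabulate (λ y → entry y T)
        sub e∈ with proj₂ (∈-filter⁻ inTuple? {xs = E} e∈)
        ... | y , refl = ∈-tabulate⁺ y

  find-tuple : ∀ E i → k ≤ ∑ t (λ j → indicator (hits? E j i)) →
    Σ Tuple λ T → (∀ y → entry y T ∈ E) × Ordered T
  find-tuple E i many with ∑-indicator⇒increasing (λ j → hits? E j i) t k many
  ... | f , inc , sat = (i , λ y → proj₂ (proj₁ (hit y))) ,
        (λ y → subst (_∈ E) (cong (_, proj₂ (proj₁ (hit y))) (proj₁ (proj₂ (proj₂ (hit y))))) (proj₁ (proj₂ (hit y)))) ,
        λ y y′ y<y′ → subst₂ _<_ (sym (proj₂ (proj₂ (proj₂ (hit y))))) (sym (proj₂ (proj₂ (proj₂ (hit y′))))) (inc y y′ y<y′)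
    where
    hit : ∀ y → Σ Entry λ e → e ∈ E × proj₁ e ≡ i × β (proj₂ e) ≡ f y
    hit y = find (proj₁ (sat y))

  -- Greedy removal, with `n` as fuel. Later tuples are drawn from what is left after deleting all
  -- entries of `T`, hence are distinct from it.
  decompose : ∀ n E Rs → length E ≤ n → Unique E → Decomposition E Rs
  decompose n E Rs len E! with any? (λ i → k ≤? ∑ t (λ j → indicator (hits? E j i))) Rs
  ... | no none = record
    { rest = E ; tuples = [] ; rest⊆ = id ; rest! = E! ; tuples⊆ = λ () ; tuples! = [] ; ordered = λ ()
    ; size = m≤m+n _ _ ; concentrated = All.map (<⇒≤ ∘ ≰⇒>) (All.¬Any⇒All¬ Rs none) }
  ... | yes some with find some
  ...   | i , _ , many with find-tuple E i many
  decompose zero    []  Rs len E! | yes _ | i , _ , _ | T , T∈ , _ = contradiction (T∈ y*) λ ()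
  decompose (suc n) E Rs len E! | yes _ | i , _ , _ | T , T∈ , T-ord = record
    { rest         = rest D
    ; tuples       = T ∷ tuples D
    ; rest⊆        = λ e∈ → proj₁ (remove⁻ E T (rest⊆ D e∈))
    ; rest!        = rest! D
    ; tuples⊆      = λ { (here refl) → T∈ ; (there T′∈) y → proj₁ (remove⁻ E T (tuples⊆ D T′∈ y)) }
    ; tuples!      = All.tabulate (λ T′∈ y eq → proj₂ (remove⁻ E T (tuples⊆ D T′∈ y)) (y , sym eq)) ∷ tuples! D
    ; ordered      = λ { (here refl) → T-ord ; (there T′∈) → ordered D T′∈ }
    ; size         = begin
        length E                                              ≤⟨ length-remove E T E! ⟩
        length (remove E T) + k                               ≤⟨ +-monoˡ-≤ k (size D) ⟩
        length (rest D) + k * length (tuples D) + k           ≡⟨ regroup (length (rest D)) k (length (tuples D)) ⟩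
        length (rest D) + k * suc (length (tuples D))         ∎
    ; concentrated = concentrated D
    }
    where
    open ≤-Reasoning
    -- The column `y*` of `P` guarantees that `T` has an entry to delete, so the fuel suffices.
    shorter : length (remove E T) < length E
    shorter = List.filter-notAll (¬? ∘ inTuple? E T) E (lose (T∈ y*) λ ¬in → ¬in (y* , refl))
    D : Decomposition (remove E T) Rs
    D = decompose n (remove E T) Rs (s≤s⁻¹ (≤-trans shorter len)) (Unique.filter⁺ (¬? ∘ inTuple? E T) E!)
    regroup : ∀ a k b → a + k * b + k ≡ a + k * suc b
    regroup = solve-∀

-- Recursive bound for pattern-free lists of entries.

module Bound {l k : ℕ} (P : Matrix l k) (degenerate : VerticallyDegenerate P) (0<l : 0 < l) (y* : Fin k)
             (t R : ℕ) {{t≢0 : NonZero t}} {{R≢0 : NonZero R}} where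

  open Pattern P
  open Density P degenerate y* R

  -- Leftover entries and tuples each get half of the bound, which gives the factor 2 in `K` and
  -- `D₀`. The `k` in `K` counts the blocks per row; in `D₀`, `k` counts the entries per tuple and
  -- `t ^ k` is the cost of pigeonhole.
  D₀ H C K : ℕ
  D₀ = 2 * k * t ^ k
  H = proj₁ (dense⇒embedding l D₀)
  C = R ^ H
  K = 2 * k

  instance
    k≢0 : NonZero k
    k≢0 = >-nonZero (≤-trans (s≤s z≤n) (Fin.toℕ<n y*))
    C≢0 : NonZero C
    C≢0 = m^n≢0 R H
    K≢0 : NonZero K
    K≢0 = m*n≢0 2 k

  Located : List Entry → List ℕ → List ℕ → ℕ → ℕ → ℕ → ℕ → Set
  Located E Rs Cs lo a lo′ b = ∀ {e} → e ∈ E →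
    proj₁ e ∈ Rs × proj₂ e ∈ Cs × Window lo (R ^ a) (proj₁ e) × Window lo′ (t ^ b) (proj₂ e)

  -- A window of `R ^ a` rows and `t ^ b` columns costs the factors `2 ^ a` and `K ^ b`. These
  -- become small powers of the side lengths once `R` and `t` are chosen as high powers of `2` and
  -- `K`.
  Bounded-at : ℕ → ℕ → Set
  Bounded-at b a = ∀ E → ¬ Contains E → Unique E → ∀ Rs Cs lo lo′ → Located E Rs Cs lo a lo′ b →
    length E ≤ C * K ^ b * (length Rs + length Cs) * 2 ^ a

  scale : ∀ b a {m n} → m ≤ n → m ≤ C * K ^ b * n * 2 ^ a
  scale b a {m} {n} m≤n = begin
    m                    ≤⟨ m≤n ⟩
    n                    ≤⟨ m≤n*m n (C * K ^ b) {{m*n≢0 C (K ^ b) {{C≢0}} {{m^n≢0 K b}}}} ⟩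
    C * K ^ b * n        ≤⟨ m≤m*n _ (2 ^ a) {{m^n≢0 2 a}} ⟩
    C * K ^ b * n * 2 ^ a ∎
    where open ≤-Reasoning

  -- A window of width `t ^ 0` is a single column, with at most one entry per row.
  one-column : ∀ a → Bounded-at 0 a
  one-column a E _ E! Rs Cs lo lo′ loc = scale 0 a (≤-trans
    (≤-trans (Unique-⊆⇒length-≤ E! sub) (≤-reflexive (List.length-map (_, lo′) Rs))) (m≤m+n _ _))
    where
    sub : ∀ {e} → e ∈ E → e ∈ map (_, lo′) Rs
    sub {i , c} e∈ with loc e∈
    ... | i∈ , _ , _ , (≤c , c<) =
      subst (λ c → (i , c) ∈ map (_, lo′) Rs) (≤-antisym ≤c (s≤s⁻¹ (≤-trans c< (≤-reflexive (+-comm lo′ 1)))))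
        (∈-map⁺ (_, lo′) i∈)

  -- Below the threshold there are at most `R ^ H` rows, so a column has at most that many entries;
  -- the constant `C` absorbs this.
  few-rows : ∀ b a → a < H → Bounded-at b a
  few-rows b a a<H E _ E! Rs Cs lo lo′ loc = begin
    length E                                        ≤⟨ Unique-⊆⇒length-≤ E! sub ⟩
    length (cartesianProduct rows Cs)               ≡⟨ length-cartesianProduct rows Cs ⟩
    length rows * length Cs                         ≡⟨ cong (_* length Cs) (trans (List.length-map (lo +_) (upTo (R ^ a))) (List.length-upTo (R ^ a))) ⟩
    R ^ a * length Cs                               ≤⟨ *-mono-≤ (^-monoʳ-≤ R (<⇒≤ a<H)) (m≤n+m (length Cs) (length Rs)) ⟩
    C * (length Rs + length Cs)                     ≤⟨ *-monoˡ-≤ _ (m≤m*n C (K ^ b) {{m^n≢0 K b}}) ⟩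
    C * K ^ b * (length Rs + length Cs)             ≤⟨ m≤m*n _ (2 ^ a) {{m^n≢0 2 a}} ⟩
    C * K ^ b * (length Rs + length Cs) * 2 ^ a     ∎
    where
    open ≤-Reasoning
    rows = map (lo +_) (upTo (R ^ a))
    sub : ∀ {e} → e ∈ E → e ∈ cartesianProduct rows Cs
    sub {i , c} e∈ with loc e∈
    ... | _ , c∈ , (≤i , i<) , _ = ∈-cartesianProduct⁺
      (subst (_∈ rows) (m+[n∸m]≡n ≤i)
        (∈-map⁺ (lo +_) (∈-upTo⁺ (+-cancelˡ-< lo _ _ (subst (_< lo + R ^ a) (sym (m+[n∸m]≡n ≤i)) i<))))) c∈
    length-cartesianProduct : ∀ (xs ys : List ℕ) → length (cartesianProduct xs ys) ≡ length xs * length ys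
    length-cartesianProduct []       ys = refl
    length-cartesianProduct (x ∷ xs) ys = trans (List.length-++ (map (x ,_) ys))
      (cong₂ _+_ (List.length-map (x ,_) ys) (length-cartesianProduct xs ys))

  module Induction (b a : ℕ) (H≤a : H ≤ a) (narrower : Bounded-at b a) (shorter : ∀ a′ → a′ < a → Bounded-at (suc b) a′)
                   (E : List Entry) (P-free : ¬ Contains E) (E! : Unique E) (Rs Cs : List ℕ) (lo lo′ : ℕ)
                   (loc : Located E Rs Cs lo a lo′ (suc b)) where

    open ≤-Reasoning

    instance
      w≢0 : NonZero (t ^ b)
      w≢0 = m^n≢0 t b

    β : ℕ → ℕ
    β = block lo′ (t ^ b)

    open Extraction P y* β t

    D : Decomposition E Rs
    D = decompose (length E) E Rs ≤-refl E!
    open Decomposition D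

    β< : ∀ {e} → e ∈ E → β (proj₂ e) < t
    β< e∈ = block-< lo′ (t ^ b) t (proj₂ (proj₂ (proj₂ (loc e∈))))

    lines V₀ V : ℕ
    lines = length Rs + length Cs
    V₀ = C * K ^ b
    V = C * K ^ suc b

    -- The narrower bound is applied in each of the `t` column blocks. By `concentrated` a row is
    -- counted in at most `k` blocks, and a column in at most one. Doubling turns `k` into `K`.
    rest-bound : 2 * length rest ≤ V * lines * 2 ^ a
    rest-bound = begin
      2 * length rest                          ≤⟨ *-monoʳ-≤ 2 (length-≤-∑-fibres (β ∘ proj₂) t rest (β< ∘ rest⊆)) ⟩
      2 * ∑ t (length ∘ part)                  ≤⟨ *-monoʳ-≤ 2 (∑-mono-≤ t λ j _ → ≤-trans (part-bound j) (≤-reflexive (swap V₀ _ (2 ^ a)))) ⟩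
      2 * ∑ t (λ j → V₀ * 2 ^ a * (length (Rs′ j) + length (Cs′ j)))
        ≡⟨ cong (2 *_) (trans (∑-*ˡ t (V₀ * 2 ^ a) _) (cong (V₀ * 2 ^ a *_) (∑-+ t (length ∘ Rs′) (length ∘ Cs′)))) ⟩
      2 * (V₀ * 2 ^ a * (∑ t (length ∘ Rs′) + ∑ t (length ∘ Cs′)))
        ≤⟨ *-monoʳ-≤ 2 (*-monoʳ-≤ (V₀ * 2 ^ a) (+-mono-≤ (∑-length-filter-≤ (hits? rest) t k Rs concentrated)
             (≤-trans (∑-fibres-≤-length β t Cs) (m≤n*m (length Cs) k)))) ⟩
      2 * (V₀ * 2 ^ a * (k * length Rs + k * length Cs))
        ≡⟨ collect C (K ^ b) (2 ^ a) k (length Rs) (length Cs) ⟩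
      V * lines * 2 ^ a ∎
      where
      swap : ∀ v x s → v * x * s ≡ v * s * x
      swap = solve-∀
      collect : ∀ c κ s k r q → 2 * (c * κ * s * (k * r + k * q)) ≡ c * (2 * k * κ) * (r + q) * s
      collect = solve-∀
      part : ℕ → List Entry
      part j = filter (λ e → β (proj₂ e) ≟ j) rest
      Rs′ Cs′ : ℕ → List ℕ
      Rs′ j = filter (hits? rest j) Rs
      Cs′ j = filter (λ c → β c ≟ j) Cs
      part-bound : ∀ j → length (part j) ≤ V₀ * (length (Rs′ j) + length (Cs′ j)) * 2 ^ a
      part-bound j = narrower (part j) (P-free ∘ Contains-mono part⊆) (Unique.filter⁺ (λ e → β (proj₂ e) ≟ j) rest!)
        (Rs′ j) (Cs′ j) lo (lo′ + j * t ^ b) located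
        where
        part⊆ : ∀ {e} → e ∈ part j → e ∈ E
        part⊆ e∈ = rest⊆ (proj₁ (∈-filter⁻ (λ e → β (proj₂ e) ≟ j) e∈))
        located : Located (part j) (Rs′ j) (Cs′ j) lo a (lo′ + j * t ^ b) b
        located e∈ with ∈-filter⁻ (λ e → β (proj₂ e) ≟ j) {xs = rest} e∈
        ... | e∈rest , eq with loc (rest⊆ e∈rest)
        ...   | i∈ , c∈ , i-in , c-in =
          ∈-filter⁺ (hits? rest j) i∈ (lose e∈rest (refl , eq)) ,
          ∈-filter⁺ (λ c → β c ≟ j) c∈ eq ,
          i-in , fibre-window lo′ (t ^ b) (proj₁ c-in) eq

    -- Pigeonhole gives a family `F` whose `y`-th columns all lie in one block `τ y`. Were `F`
    -- dense, it would embed all rows of `P`, and the blocks would put the columns in order,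
    -- contradicting `P-free`.
    tuples-bound : 2 * (k * length tuples) ≤ V * lines * 2 ^ a
    tuples-bound with monochromatic t k (λ y T → β (cols T y)) tuples (λ T∈ y → β< (tuples⊆ T∈ y)) tuples!
    ... | F , τ , F⊆ , F! , mono , large = begin
      2 * (k * length tuples)          ≤⟨ *-monoʳ-≤ 2 (*-monoʳ-≤ k large) ⟩
      2 * (k * (t ^ k * length F))     ≡⟨ regroup k (t ^ k) (length F) ⟩
      D₀ * length F                    ≤⟨ ≮⇒≥ (λ dense → P-free (contains (proj₂ (dense⇒embedding l D₀) a H≤a V E Rs Cs
                                            bounded (λ e∈ → proj₁ (loc e∈) , proj₁ (proj₂ (loc e∈))) 0 l 0<l ≤-refl ≤-refl
                                            F lo F! (tuples⊆ ∘ F⊆) (λ T∈ → proj₁ (proj₂ (proj₂ (loc (tuples⊆ (F⊆ T∈) y*))))) dense))) ⟩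
      V * lines * 2 ^ a                    ∎
      where
      regroup : ∀ k u f → 2 * (k * (u * f)) ≡ 2 * k * u * f
      regroup = solve-∀
      bounded : ∀ a′ → a′ < a → Bounded V E a′
      bounded a′ a′<a E′ E′! sub Rs Cs lo loc′ = shorter a′ a′<a E′ (P-free ∘ Contains-mono sub) E′! Rs Cs lo lo′
        λ e∈ → let i∈ , c∈ , i-in = loc′ e∈ in i∈ , c∈ , i-in , proj₂ (proj₂ (proj₂ (loc (sub e∈))))
      contains : Embedding 0 l F → Contains E
      contains ε = (row ∘ tuple) , col ,
        (λ x x′ → row-mono x x′ (all x) (all x′)) ,
        (λ y y′ y<y′ → block-reflects-< lo′ (t ^ b) (subst₂ _<_ (sym (β-col y)) (sym (β-col y′)) (τ-mono y<y′))) ,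
        -- The row `x` of `P` may be empty; the tuple's entry at `y*` still shows that its image
        -- occurs in `E`.
        (λ x → cols (tuple x) y* , tuples⊆ (F⊆ (tuple∈ x (all x))) y*) ,
        supported-entry ,
        (λ x y one → subst (λ c → (row (tuple x) , c) ∈ E) (match x y (all x) one) (tuples⊆ (F⊆ (tuple∈ x (all x))) y))
        where
        open Embedding ε
        all : ∀ x → Between 0 l x
        all x = z≤n , Fin.toℕ<n x
        supported-entry : ∀ y → ∃ λ i → (i , col y) ∈ E
        supported-entry y with supported y
        ... | x , btw , eq = row (tuple x) , subst (λ c → (row (tuple x) , c) ∈ E) eq (tuples⊆ (F⊆ (tuple∈ x btw)) y)
        -- Column order, absent from `Embedding`, is recovered here: `col y` lies in block `τ y`,
        -- and `τ` increases because the tuples are `Ordered`.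
        β-col : ∀ y → β (col y) ≡ τ y
        β-col y with supported y
        ... | x , btw , eq = trans (cong β (sym eq)) (mono (tuple∈ x btw) y)
        τ-mono : ∀ {y y′} → toℕ y < toℕ y′ → τ y < τ y′
        τ-mono {y} {y′} y<y′ with supported y
        ... | x , btw , _ = subst₂ _<_ (mono (tuple∈ x btw) y) (mono (tuple∈ x btw) y′) (ordered (F⊆ (tuple∈ x btw)) y y′ y<y′)

    bound : length E ≤ V * lines * 2 ^ a
    bound = *-cancelˡ-≤ 2 (begin
      2 * length E                                       ≤⟨ *-monoʳ-≤ 2 size ⟩
      2 * (length rest + k * length tuples)              ≡⟨ *-distribˡ-+ 2 (length rest) _ ⟩
      2 * length rest + 2 * (k * length tuples)          ≤⟨ +-mono-≤ rest-bound tuples-bound ⟩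
      V * lines * 2 ^ a + V * lines * 2 ^ a                      ≡⟨ cong (V * lines * 2 ^ a +_) (+-identityʳ _) ⟨
      2 * (V * lines * 2 ^ a)                                ∎)

  -- Recursion on the width exponent `b` and, inside it, strong induction on the height exponent
  -- `a`, with `n` as fuel.
  P-free-bound : ∀ b a → Bounded-at b a
  P-free-bound zero    = one-column
  P-free-bound (suc b) a = strong (suc a) a ≤-refl
    where
    strong : ∀ n a → a < n → Bounded-at (suc b) a
    strong (suc n) a (s≤s a≤n) with H ≤? a
    ... | no  H≰a = few-rows (suc b) a (≰⇒> H≰a)
    ... | yes H≤a = Induction.bound b a H≤a (P-free-bound b a) (λ a′ a′<a → strong n a′ (≤-trans a′<a a≤n))

-- From matrices to lists of entries.

module _ {m n : ℕ} (A : Matrix m n) where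

  One : Fin m × Fin n → Set
  One (i , j) = A i j ≡ true

  One? : Decidable One
  One? (i , j) = A i j Bool.≟ true

  position : Fin m × Fin n → Entry
  position (i , j) = toℕ i , toℕ j

  ones : List Entry
  ones = map position (filter One? (cartesianProduct (allFin m) (allFin n)))

  ones⁻ : ∀ {e} → e ∈ ones → Σ (Fin m) λ i → Σ (Fin n) λ j → e ≡ (toℕ i , toℕ j) × A i j ≡ true
  ones⁻ e∈ with ∈-map⁻ position e∈
  ... | (i , j) , ij∈ , eq = i , j , eq , proj₂ (∈-filter⁻ One? {xs = cartesianProduct (allFin m) (allFin n)} ij∈)

  ones! : Unique ones
  ones! = Unique.map⁺ injective (Unique.filter⁺ One? (Unique.cartesianProduct⁺ (Unique.allFin⁺ m) (Unique.allFin⁺ n)))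
    where
    injective : ∀ {p q} → position p ≡ position q → p ≡ q
    injective eq = cong₂ _,_ (Fin.toℕ-injective (cong proj₁ eq)) (Fin.toℕ-injective (cong proj₂ eq))

  length-ones : length ones ≡ weight A
  length-ones = trans (List.length-map position (filter One? (cartesianProduct (allFin m) (allFin n)))) (all-rows (allFin m))
    where
    open ≡-Reasoning
    one-row : ∀ i js → length (filter One? (map (i ,_) js)) ≡ sum (map (λ j → if A i j then 1 else 0) js)
    one-row i []       = refl
    one-row i (j ∷ js) with A i j
    ... | true  = cong suc (one-row i js)
    ... | false = one-row i js
    all-rows : ∀ is → length (filter One? (cartesianProduct is (allFin n))) ≡
      sum (map (λ i → sum (map (λ j → if A i j then 1 else 0) (allFin n))) is)
    all-rows []       = refl
    all-rows (i ∷ is) = begin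
      length (filter One? (map (i ,_) (allFin n) ++ cartesianProduct is (allFin n)))
        ≡⟨ cong length (List.filter-++ One? (map (i ,_) (allFin n)) _) ⟩
      length (filter One? (map (i ,_) (allFin n)) ++ filter One? (cartesianProduct is (allFin n)))
        ≡⟨ List.length-++ (filter One? (map (i ,_) (allFin n))) ⟩
      length (filter One? (map (i ,_) (allFin n))) + length (filter One? (cartesianProduct is (allFin n)))
        ≡⟨ cong₂ _+_ (one-row i (allFin n)) (all-rows is) ⟩
      sum (map (λ i → sum (map (λ j → if A i j then 1 else 0) (allFin n))) (i ∷ is)) ∎

  -- Each `f x` and `g y` is a coordinate of an actual one of `A`, which supplies the index in
  -- `Fin`.
  contains⇒≺ : ∀ {l k} (P : Matrix l k) → Pattern.Contains P ones → P ≺ A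
  contains⇒≺ {l} {k} P (f , g , f-inc , g-inc , rows , columns , match) =
    f′ , g′ ,
    (λ x x′ x<x′ → subst₂ _<_ (sym (f′≡ x)) (sym (f′≡ x′)) (f-inc x x′ x<x′)) ,
    (λ y y′ y<y′ → subst₂ _<_ (sym (g′≡ y)) (sym (g′≡ y′)) (g-inc y y′ y<y′)) ,
    one
    where
    f′ : Fin l → Fin m
    f′ x = proj₁ (ones⁻ (proj₂ (rows x)))
    f′≡ : ∀ x → toℕ (f′ x) ≡ f x
    f′≡ x = sym (cong proj₁ (proj₁ (proj₂ (proj₂ (ones⁻ (proj₂ (rows x)))))))
    g′ : Fin k → Fin n
    g′ y = proj₁ (proj₂ (ones⁻ (proj₂ (columns y))))
    g′≡ : ∀ y → toℕ (g′ y) ≡ g y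
    g′≡ y = sym (cong proj₂ (proj₁ (proj₂ (proj₂ (ones⁻ (proj₂ (columns y)))))))
    one : ∀ x y → P x y ≡ true → A (f′ x) (g′ y) ≡ true
    one x y Pxy with ones⁻ (match x y Pxy)
    ... | i , j , eq , Aij = subst₂ (λ i j → A i j ≡ true)
      (Fin.toℕ-injective (trans (sym (cong proj₁ eq)) (sym (f′≡ x))))
      (Fin.toℕ-injective (trans (sym (cong proj₂ eq)) (sym (g′≡ y)))) Aij

-- From the recursive bound to an exponent close to 1.

ceiling-log : ∀ B → 2 ≤ B → ∀ n → 1 ≤ n → Σ ℕ λ a → n ≤ B ^ a × B ^ a ≤ B * n
ceiling-log B 2≤B (suc zero)        _ = 0 , ≤-refl , ≤-trans (≤-trans (n≤1+n 1) 2≤B) (≤-reflexive (sym (*-identityʳ B)))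
ceiling-log B 2≤B n′@(suc n@(suc _)) _ with ceiling-log B 2≤B n (s≤s z≤n)
... | a , n≤ , ≤Bn with suc n ≤? B ^ a
...   | yes fits  = a , fits , ≤-trans ≤Bn (*-monoʳ-≤ B (n≤1+n n))
-- Here `B ^ a` equals `n`, so one more factor `B` reaches `suc n` and overshoots by at most `B`.
...   | no  n≮B^a = suc a , grow , *-monoʳ-≤ B (≤-trans (s≤s⁻¹ (≰⇒> n≮B^a)) (n≤1+n n))
  where
  open ≤-Reasoning
  grow : n′ ≤ B ^ suc a
  grow = begin
    suc n            ≤⟨ +-mono-≤ (s≤s {0} z≤n) ≤-refl ⟩
    n + n            ≡⟨ cong (n +_) (+-identityʳ n) ⟨
    2 * n            ≤⟨ *-mono-≤ 2≤B n≤ ⟩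
    B * B ^ a        ∎

2≤m^suc : ∀ m n → 2 ≤ m → 2 ≤ m ^ suc n
2≤m^suc m n 2≤m = ≤-trans 2≤m (m≤m*n m (m ^ n) {{m^n≢0 m n {{>-nonZero (≤-trans (s≤s z≤n) 2≤m)}}}})

^-cancelˡ-≤ : ∀ n .{{_ : NonZero n}} {a b} → a ^ n ≤ b ^ n → a ≤ b
^-cancelˡ-≤ n le = ≮⇒≥ λ b<a → <⇒≱ (^-monoˡ-< n b<a) le

^-distribʳ-* : ∀ n a b → (a * b) ^ n ≡ a ^ n * b ^ n
^-distribʳ-* zero    a b = refl
^-distribʳ-* (suc n) a b = trans (cong (a * b *_) (^-distribʳ-* n a b)) (interchange a b (a ^ n) (b ^ n))
  where
  interchange : ∀ a b c d → a * b * (c * d) ≡ a * c * (b * d)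
  interchange = solve-∀

-- With t = K ^ d and R = 2 ^ d, the d-th powers of the factors K ^ b and 2 ^ a are t ^ b ≤ t * n and R ^ a ≤ R * n.
power-bound : ∀ d C K t R w n a b → t ≡ K ^ d → R ≡ 2 ^ d → w ≤ C * K ^ b * (n + n) * 2 ^ a →
  t ^ b ≤ t * n → R ^ a ≤ R * n → w ^ d ≤ (2 * C) ^ d * t * R * n ^ (2 + d)
power-bound d C K t R w n a b refl refl w≤ tb≤ Ra≤ = begin
  w ^ d                                                  ≤⟨ ^-monoˡ-≤ d w≤ ⟩
  (C * K ^ b * (n + n) * 2 ^ a) ^ d                      ≡⟨ cong (_^ d) (regroup C (K ^ b) n (2 ^ a)) ⟩
  (2 * C * n * K ^ b * 2 ^ a) ^ d                        ≡⟨ ^-distribʳ-* d (2 * C * n * K ^ b) (2 ^ a) ⟩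
  (2 * C * n * K ^ b) ^ d * (2 ^ a) ^ d                  ≡⟨ cong₂ _*_ (^-distribʳ-* d (2 * C * n) (K ^ b)) (^-swap 2 a) ⟩
  (2 * C * n) ^ d * (K ^ b) ^ d * (2 ^ d) ^ a            ≡⟨ cong (_* (2 ^ d) ^ a) (cong₂ _*_ (^-distribʳ-* d (2 * C) n) (^-swap K b)) ⟩
  (2 * C) ^ d * n ^ d * (K ^ d) ^ b * (2 ^ d) ^ a        ≤⟨ *-mono-≤ (*-monoʳ-≤ ((2 * C) ^ d * n ^ d) tb≤) Ra≤ ⟩
  (2 * C) ^ d * n ^ d * (K ^ d * n) * (2 ^ d * n)        ≡⟨ collect ((2 * C) ^ d) (n ^ d) (K ^ d) (2 ^ d) n ⟩
  (2 * C) ^ d * K ^ d * 2 ^ d * n ^ (2 + d)              ∎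
  where
  open ≤-Reasoning
  ^-swap : ∀ m c → (m ^ c) ^ d ≡ (m ^ d) ^ c
  ^-swap m c = trans (^-*-assoc m c d) (trans (cong (m ^_) (*-comm c d)) (sym (^-*-assoc m d c)))
  regroup : ∀ C κ n s → C * κ * (n + n) * s ≡ 2 * C * n * κ * s
  regroup = solve-∀
  collect : ∀ c ν t r n → c * ν * (t * n) * (r * n) ≡ c * t * r * (n * (n * ν))
  collect = solve-∀

-- The exponent `1 + o(1)` in integer form: for each `e`, all large `n` satisfy
-- `w ≤ n ^ (1 + 1 / (e + 1))`. The finitely many smaller `n` are absorbed by the choice of `ε(n)`.
theorem1 : (l k : ℕ) (P : Matrix l k) → VerticallyDegenerate P → HasOne P →
    (e : ℕ) → Σ ℕ λ N → (n : ℕ) → N ≤ n → (A : Matrix n n) → ¬ (P ≺ A) →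
      weight A ^ suc e ≤ n ^ suc (suc e)
theorem1 l k P degenerate (x* , y* , _) e = suc c , final
  where
  d K t R c : ℕ
  -- `power-bound` leaves `n ^ (2 + d)` times a constant `c`. One more factor `n > c` absorbs the
  -- constant, and `3 + d` is three times `suc (suc e)`, so a cube root gives the claim.
  d = suc e * 3
  K = 2 * k
  t = K ^ d
  R = 2 ^ d

  2≤K : 2 ≤ K
  2≤K = *-monoʳ-≤ 2 (≤-trans (s≤s z≤n) (Fin.toℕ<n y*))

  instance
    t≢0 : NonZero t
    t≢0 = m^n≢0 K d {{>-nonZero (≤-trans (s≤s z≤n) 2≤K)}}
    R≢0 : NonZero R
    R≢0 = m^n≢0 2 d

  open Bound P degenerate (≤-trans (s≤s z≤n) (Fin.toℕ<n x*)) y* t R using (C; P-free-bound)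

  c = (2 * C) ^ d * t * R

  final : ∀ n → suc c ≤ n → (A : Matrix n n) → ¬ (P ≺ A) → weight A ^ suc e ≤ n ^ suc (suc e)
  final n c<n A P⊀A with ceiling-log R (2≤m^suc 2 (2 + e * 3) ≤-refl) n (≤-trans (s≤s z≤n) c<n)
                       | ceiling-log t (2≤m^suc K (2 + e * 3) 2≤K) n (≤-trans (s≤s z≤n) c<n)
  ... | a , n≤R^a , R^a≤ | b , n≤t^b , t^b≤ = ^-cancelˡ-≤ 3 (begin
    (weight A ^ suc e) ^ 3       ≡⟨ ^-*-assoc (weight A) (suc e) 3 ⟩
    weight A ^ d                 ≤⟨ power-bound d C K t R (weight A) n a b refl refl weight-bound t^b≤ R^a≤ ⟩
    c * n ^ (2 + d)              ≤⟨ *-monoˡ-≤ (n ^ (2 + d)) (<⇒≤ c<n) ⟩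
    n ^ (suc (suc e) * 3)        ≡⟨ ^-*-assoc n (suc (suc e)) 3 ⟨
    (n ^ suc (suc e)) ^ 3        ∎)
    where
    open ≤-Reasoning
    located : ∀ {e} → e ∈ ones A → proj₁ e ∈ upTo n × proj₂ e ∈ upTo n × Window 0 (R ^ a) (proj₁ e) × Window 0 (t ^ b) (proj₂ e)
    located e∈ with ones⁻ A e∈
    ... | i , j , refl , _ = ∈-upTo⁺ (Fin.toℕ<n i) , ∈-upTo⁺ (Fin.toℕ<n j) ,
      (z≤n , <-≤-trans (Fin.toℕ<n i) n≤R^a) , (z≤n , <-≤-trans (Fin.toℕ<n j) n≤t^b)
    weight-bound : weight A ≤ C * K ^ b * (n + n) * 2 ^ a
    weight-bound = subst₂ (λ w x → w ≤ C * K ^ b * (x + x) * 2 ^ a) (length-ones A) (List.length-upTo n)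
      (P-free-bound b a (ones A) (P⊀A ∘ contains⇒≺ A P) (ones! A) (upTo n) (upTo n) 0 0 located)
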